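{- Let $K=\{123,132,312\}$ and let $f(n)$ be the number of equivalence classes of $S_n$ under $K$-equivalence. Then $f(3)=4$, $f(4)=9$, and for all integers $n\ge 5$, $$f(n)=f(n-1)+(n-2)\cdot f(n-2)+1.$$
   Context: Permutations in $S_n$ are written as words $\pi_1\pi_2\cdots\pi_n$ in one-line notation. The order permutation of a word $u$ of $c$ distinct positive integers is the unique $\sigma\in S_c$ with $\sigma_i<\sigma_j$ iff $u_i<u_j$. A replacement partition $K$ of $S_c$ is a set partition of $S_c$; it is denoted by listing its parts with the one-element parts (and outer brackets) omitted, so here $K$ is the set partition of $S_3$ whose only part of size greater than one is $\{123,132,312\}$. The $K$-equivalence on $S_n$ is the equivalence relation generated by: $\phi\equiv\psi$ whenever $\phi=aub$ and $\psi=avb$ (concatenations) for some possibly empty words $a,b$ and words $u,v$ of length $c$ (so $u,v$ occupy the same $c$ consecutive positions) such that the order permutations of $u$ and $v$ lie in the same part of $K$. All equivalence classes are counted, including one-element classes. -}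

module Defs where

open import Level using (0ℓ)
open import Data.Nat using (ℕ; suc; _<_)
open import Data.Fin using (Fin)
open import Data.Fin.Permutation using (↔⇒≡)
open import Data.List using (List; []; _∷_; _++_; map; upTo)
open import Data.List.Membership.Propositional using (_∈_)
open import Data.List.Relation.Binary.Permutation.Propositional using (_↭_)
open import Data.List.Relation.Unary.Any using (Any)
open import Data.Product using (∃; _×_; proj₁)
open import Data.Sum using (_⊎_)
open import Data.Vec as Vec using (Vec; lookup; toList)
open import Function.Bundles using (Bijection; _⇔_)
open import Function.Construct.Composition using (inverse)
open import Function.Construct.Symmetry using () renaming (inverse to sym-inverse)
open import Function.Properties.Bijection using (Bijection⇒Inverse)
open import Relation.Binary using (Rel; Setoid)
open import Relation.Binary.Construct.Closure.Equivalence using (EqClosure)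
import Relation.Binary.Construct.Closure.Equivalence as EqClosure
import Relation.Binary.Construct.On as On
open import Relation.Binary.PropositionalEquality using (_≡_; setoid)

-- One-line notation: w is a permutation of the letters 1, …, n.
IsPerm : ℕ → List ℕ → Set
IsPerm n w = w ↭ map suc (upTo n)

S : ℕ → Set
S n = ∃ (IsPerm n)

infix 4 _IsOrderPermOf_

_IsOrderPermOf_ : ∀ {c} → Vec ℕ c → Vec ℕ c → Set
_IsOrderPermOf_ {c} σ u =
  IsPerm c (toList σ) ×
  (∀ i j → (lookup σ i < lookup σ j) ⇔ (lookup u i < lookup u j))

-- A replacement partition of S_c, given by its parts of size greater than one;
-- every permutation in none of the listed parts forms a part on its own.
Parts : ℕ → Set
Parts c = List (List (Vec ℕ c))

SamePart : ∀ {c} → Parts c → Rel (Vec ℕ c) 0ℓ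
SamePart K σ τ = σ ≡ τ ⊎ Any (λ B → σ ∈ B × τ ∈ B) K

-- Both endpoints are required to be permutations, so the equivalence
-- closure below never leaves S_n (apart from its reflexive pairs).
data Replace {c} (K : Parts c) (n : ℕ) : Rel (List ℕ) 0ℓ where
  replace : ∀ (a b : List ℕ) (u v σ τ : Vec ℕ c) →
            IsPerm n (a ++ toList u ++ b) →
            IsPerm n (a ++ toList v ++ b) →
            σ IsOrderPermOf u →
            τ IsOrderPermOf v →
            SamePart K σ τ →
            Replace K n (a ++ toList u ++ b) (a ++ toList v ++ b)

-- S_n under K-equivalence. The relation only looks at the underlying words,
-- so different proofs that a word is a permutation are identified.
Equiv : ∀ {c} → Parts c → ℕ → Setoid 0ℓ 0ℓ
Equiv K n = On.setoid {B = S n} (EqClosure.setoid (Replace K n)) proj₁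

-- A bijection of setoids from Equiv K n to Fin m sends equivalent permutations,
-- and only those, to equal numbers: it numbers the equivalence classes.
HasClassCount : ∀ {c} → Parts c → ℕ → ℕ → Set
HasClassCount K n m = Bijection (Equiv K n) (setoid (Fin m))

HasClassCount-unique : ∀ {c} (K : Parts c) n {m m′} →
                       HasClassCount K n m → HasClassCount K n m′ → m ≡ m′
HasClassCount-unique K n f g =
  ↔⇒≡ (inverse (sym-inverse (Bijection⇒Inverse f)) (Bijection⇒Inverse g))

K₀ : Parts 3
K₀ = ( (1 Vec.∷ 2 Vec.∷ 3 Vec.∷ Vec.[])
     ∷ (1 Vec.∷ 3 Vec.∷ 2 Vec.∷ Vec.[])
     ∷ (3 Vec.∷ 1 Vec.∷ 2 Vec.∷ Vec.[])
     ∷ [] ) ∷ []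

{-# OPTIONS --safe #-}
module Submission where

-- For letters x < y < z the partition lets the consecutive factors xyz, xzy
-- and zxy replace each other.  So two letters preceded by a smaller one
-- commute, and a letter x may jump over a larger letter z when the letter that
-- follows the two lies strictly between them.
--
-- Let a < b be the two smallest letters of a word w = u a x.  Three facts give
-- the classes.
--
--  * A pair m e of adjacent letters with m < e moves left past letters larger
--    than e (pair-past).  Hence everything to the right of a letter m smaller
--    than all that follows may be permuted freely (permute-after-min): bring
--    the minimum e of the tail next to m, and use the pair m e as a carrier.
--  * A step changes u a x in one of three ways only (effect): it is a step
--    inside u, or it permutes x, or a jumps over a neighbour c that is larger
--    than the letter next to c in x.  In each case the minimum e of x (or the
--    fact that x is empty) is unchanged.
--  * If b lies in u, then permuting x does not change the class of u x, nor
--    that of u x with one letter other than b deleted, since the letters of x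
--    stand to the right of b and b is the least letter of u x (permute-after).
--
-- So there are three kinds of classes of words in n + 2 letters.  If x is
-- empty, the class is that of u: a word in n + 1 letters.  If b is in x, there
-- is one single class, that of the increasing word.  Otherwise the minimum e of
-- x is one of the n letters above b, and the class is determined by e and by
-- the class of the word in n letters left when a and e are deleted.  This is
-- the recursive type Code with its map code; code-~ says that the code is an
-- invariant, ~-decode that it is complete, and code-decode that all codes
-- occur.  Counting codes gives
-- f (n + 2) = f (n + 1) + n * f n + 1 with f 0 = f 1 = 1.

open import Defs
open import Level using (0ℓ)
open import Data.Nat using (ℕ; zero; suc; _+_; _*_; _∸_; _≤_; _<_; _≟_; _<?_; s≤s; z<s; s<s)
open import Data.Nat.Properties hiding (_≟_)
open import Data.Fin using (Fin; zero; suc; toℕ)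
open import Data.Fin.Patterns using (0F; 1F; 2F)
open import Data.Fin.Properties using (+↔⊎; *↔×; 1↔⊤)
open import Data.List using (List; []; _∷_; _++_; [_]; filter; length; map; upTo)
open import Data.List.Properties
  using (++-assoc; ++-identityʳ; filter-++; filter-all; filter-reject; length-map; length-upTo)
open import Data.List.Membership.DecPropositional _≟_ using (_∈?_)
open import Data.List.Membership.Propositional using (_∈_; _∉_)
open import Data.List.Membership.Propositional.Properties using (∈-∃++; ∈-++⁺ʳ; ∈-++⁻; ∈-filter⁺)
open import Data.List.Relation.Binary.Equality.Propositional using (≋⇒≡)
open import Data.List.Relation.Binary.Permutation.Propositional
open import Data.List.Relation.Binary.Permutation.Propositional.Properties
  using (↭-empty-inv; ↭-singleton-inv; ↭-length; ∈-resp-↭; All-resp-↭; ++⁺ˡ; ++-comm; shift;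
         drop-∷; drop-mid; ∷↭∷ʳ; filter-↭)
import Data.List.Relation.Binary.Permutation.Setoid.Properties as PermSetoid
open import Data.List.Relation.Binary.Sublist.Propositional using (⊆-refl)
open import Data.List.Relation.Binary.Sublist.Propositional.Properties using (length-mono-≤; filter⁺)
open import Data.List.Relation.Unary.All as All using (All; []; _∷_)
import Data.List.Relation.Unary.All.Properties as All
open import Data.List.Relation.Unary.AllPairs as AllPairs using (AllPairs; []; _∷_)
import Data.List.Relation.Unary.AllPairs.Properties as AllPairs
open import Data.List.Relation.Unary.Any using (here; there)
open import Data.List.Relation.Unary.Sorted.TotalOrder.Properties using (↗↭↗⇒≋; AllPairs⇒Sorted)
open import Data.List.Relation.Unary.Unique.Propositional using (Unique)
import Data.List.Relation.Unary.Unique.Propositional.Properties as Unique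
open import Data.Maybe as Maybe using (Maybe; nothing; just)
open import Data.Product using (Σ; ∃; ∃₂; _×_; _,_; proj₁; proj₂)
open import Data.Product.Function.NonDependent.Propositional using (_×-↔_)
open import Data.Sum using (_⊎_; inj₁; inj₂)
open import Data.Sum.Function.Propositional using (_⊎-↔_)
open import Data.Unit using (⊤; tt)
open import Data.Vec as Vec using (Vec; []; _∷_; toList; lookup; removeAt)
open import Data.Vec.Membership.Propositional.Properties using (∈-lookup; ∈-toList⁺)
open import Data.Vec.Properties using (lookup-map; toList∘fromList)
open import Data.Vec.Relation.Binary.Pointwise.Extensional using (ext; Pointwise-≡⇒≡)
open import Function using (_∘_; _⇔_; mk⇔; Equivalence; _↔_; Inverse)
open import Function.Properties.Inverse using (↔-refl; ↔-trans)
open import Relation.Binary using (Rel; Setoid; IsEquivalence; tri<; tri≈; tri>)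
open import Relation.Binary.Construct.Closure.Equivalence as Eq using (EqClosure)
open import Relation.Binary.Construct.Closure.ReflexiveTransitive using (ε; _◅_)
open import Relation.Binary.Construct.Closure.Symmetric using (fwd; bwd)
open import Relation.Binary.PropositionalEquality as ≡ using (_≡_; _≢_; cong; cong₂; sym; subst; subst₂)
import Relation.Binary.Reasoning.Setoid as SetoidReasoning
open import Relation.Nullary using (yes; no; contradiction; ¬_; ¬?)
open import Relation.Unary using (Decidable)

-- Lists with distinct entries, permutations of lists

unique-↭ : ∀ {A : Set} {z z′ : List A} → z ↭ z′ → Unique z → Unique z′
unique-↭ z↭z′ = PermSetoid.Unique-resp-↭ (≡.setoid _) (↭⇒↭ₛ z↭z′)

unique-++ˡ : ∀ {A : Set} (p : List A) {q} → Unique (p ++ q) → Unique p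
unique-++ˡ []      _          = []
unique-++ˡ (_ ∷ p) (x∉ ∷ p!) = All.++⁻ˡ p x∉ ∷ unique-++ˡ p p!

unique-++ʳ : ∀ {A : Set} (p : List A) {q} → Unique (p ++ q) → Unique q
unique-++ʳ []      q!       = q!
unique-++ʳ (_ ∷ p) (_ ∷ q!) = unique-++ʳ p q!

unique-disjoint : ∀ {A : Set} (u : List A) {x e} → Unique (u ++ x) → e ∈ x → All (e ≢_) u
unique-disjoint []      _          _   = []
unique-disjoint (y ∷ u) (y∉ ∷ ux!) e∈x =
  (λ e≡y → All.lookup (All.++⁻ʳ u y∉) e∈x (sym e≡y)) ∷ unique-disjoint u ux! e∈x

++-cancel-↭ˡ : ∀ {A : Set} (p : List A) {w w′} → p ++ w ↭ p ++ w′ → w ↭ w′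
++-cancel-↭ˡ []      w↭ = w↭
++-cancel-↭ˡ (x ∷ p) w↭ = ++-cancel-↭ˡ p (drop-∷ w↭)

++-cancel-↭ : ∀ {A : Set} (p q : List A) {u v} → p ++ u ++ q ↭ p ++ v ++ q → u ↭ v
++-cancel-↭ p q {u} {v} puq↭ =
  ++-cancel-↭ˡ q (trans (++-comm q u) (trans (++-cancel-↭ˡ p puq↭) (++-comm v q)))

lookup-∈ : ∀ {A : Set} {n} (V : Vec A n) i → lookup V i ∈ toList V
lookup-∈ V i = ∈-toList⁺ (∈-lookup i V)

removeAt-↭ : ∀ {A : Set} {n} (V : Vec A (suc n)) i → toList V ↭ lookup V i ∷ toList (removeAt V i)
removeAt-↭ (x ∷ V)         zero    = refl
removeAt-↭ (x ∷ V@(_ ∷ _)) (suc i) =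
  trans (prep x (removeAt-↭ V i)) (swap x (lookup V i) refl)

removeAt-All : ∀ {A : Set} {n} {P : A → Set} (V : Vec A (suc n)) i →
               All P (toList V) → All P (toList (removeAt V i))
removeAt-All V i p with _ ∷ p′ ← All-resp-↭ (removeAt-↭ V i) p = p′

-- Elementary moves and the equivalence that they generate

-- One replacement anywhere in a word: xyz to xzy, or xzy to zxy.  Words are
-- arbitrary lists of letters here, so that letters can be removed without
-- renaming the others.
data Step : Rel (List ℕ) 0ℓ where
  comm  : ∀ {x y z q} → x < y → y < z → Step (x ∷ y ∷ z ∷ q) (x ∷ z ∷ y ∷ q)
  move  : ∀ {x y z q} → x < y → y < z → Step (x ∷ z ∷ y ∷ q) (z ∷ x ∷ y ∷ q)
  there : ∀ {h w w′} → Step w w′ → Step (h ∷ w) (h ∷ w′)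

-- The equivalence generated by the steps.
infix 4 _~_
_~_ : Rel (List ℕ) 0ℓ
_~_ = EqClosure Step

open Setoid (Eq.setoid Step) using () renaming
  (refl to ~-refl; sym to ~-sym; trans to ~-trans; reflexive to ~-reflexive)
module ~-Reasoning = SetoidReasoning (Eq.setoid Step)

step⇒~ : ∀ {w w′} → Step w w′ → w ~ w′
step⇒~ = Eq.return

step-++ˡ : ∀ p {w w′} → Step w w′ → Step (p ++ w) (p ++ w′)
step-++ˡ []      s = s
step-++ˡ (_ ∷ p) s = there (step-++ˡ p s)

step-++ʳ : ∀ q {w w′} → Step w w′ → Step (w ++ q) (w′ ++ q)
step-++ʳ q (comm x<y y<z) = comm x<y y<z
step-++ʳ q (move x<y y<z) = move x<y y<z
step-++ʳ q (there s)      = there (step-++ʳ q s)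

~-++ˡ : ∀ p {w w′} → w ~ w′ → p ++ w ~ p ++ w′
~-++ˡ p = Eq.gmap (p ++_) (step-++ˡ p)

~-++ʳ : ∀ q {w w′} → w ~ w′ → w ++ q ~ w′ ++ q
~-++ʳ q = Eq.gmap (_++ q) (step-++ʳ q)

step⇒↭ : ∀ {w w′} → Step w w′ → w ↭ w′
step⇒↭ (comm _ _) = prep _ (swap _ _ refl)
step⇒↭ (move _ _) = swap _ _ refl
step⇒↭ (there s)  = prep _ (step⇒↭ s)

~⇒↭ : ∀ {w w′} → w ~ w′ → w ↭ w′
~⇒↭ = Eq.fold ↭-isEquivalence step⇒↭

swap-above : ∀ {m x y} q → m < x → m < y → m ∷ x ∷ y ∷ q ~ m ∷ y ∷ x ∷ q
swap-above {m} {x} {y} q m<x m<y with <-cmp x y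
... | tri< x<y _ _      = step⇒~ (comm m<x x<y)
... | tri≈ _ ≡.refl _   = ~-refl
... | tri> _ _ y<x      = ~-sym (step⇒~ (comm m<y y<x))

pair-past-letter : ∀ {m e c} q → m < e → e < c → c ∷ m ∷ e ∷ q ~ m ∷ e ∷ c ∷ q
pair-past-letter q m<e e<c =
  ~-trans (~-sym (step⇒~ (move m<e e<c))) (~-sym (step⇒~ (comm m<e e<c)))

-- The carrier: a pair m e with m < e moves left past letters larger than e.
pair-past : ∀ {m e} p {q} → m < e → All (e <_) p → p ++ m ∷ e ∷ q ~ m ∷ e ∷ p ++ q
pair-past []      m<e []          = ~-refl
pair-past (c ∷ p) m<e (e<c ∷ e<p) =
  ~-trans (~-++ˡ [ c ] (pair-past p m<e e<p)) (pair-past-letter _ m<e e<c)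

-- Carry the pair m e to the place of an adjacent transposition, swap there
-- behind e, and carry it back.
permute-after-pair : ∀ {m e r r′} → m < e → All (e <_) r → r ↭ r′ →
                     m ∷ e ∷ r ~ m ∷ e ∷ r′
permute-after-pair m<e e<r refl = ~-refl
permute-after-pair {m} {e} m<e (e<x ∷ e<r) (prep {r} {r′} x r↭r′) = begin
  m ∷ e ∷ x ∷ r   ≈⟨ pair-past-letter r m<e e<x ⟨
  x ∷ m ∷ e ∷ r   ≈⟨ ~-++ˡ [ x ] (permute-after-pair m<e e<r r↭r′) ⟩
  x ∷ m ∷ e ∷ r′  ≈⟨ pair-past-letter r′ m<e e<x ⟩
  m ∷ e ∷ x ∷ r′  ∎
  where open ~-Reasoning
permute-after-pair {m} {e} m<e (e<x ∷ e<y ∷ e<r) (swap {r} {r′} x y r↭r′) = begin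
  m ∷ e ∷ x ∷ y ∷ r   ≈⟨ ~-++ˡ [ m ] (swap-above r e<x e<y) ⟩
  m ∷ e ∷ y ∷ x ∷ r   ≈⟨ pair-past (y ∷ x ∷ []) m<e (e<y ∷ e<x ∷ []) ⟨
  y ∷ x ∷ m ∷ e ∷ r   ≈⟨ ~-++ˡ (y ∷ x ∷ []) (permute-after-pair m<e e<r r↭r′) ⟩
  y ∷ x ∷ m ∷ e ∷ r′  ≈⟨ pair-past (y ∷ x ∷ []) m<e (e<y ∷ e<x ∷ []) ⟩
  m ∷ e ∷ y ∷ x ∷ r′  ∎
  where open ~-Reasoning
permute-after-pair m<e e<r (trans r↭s s↭r′) =
  ~-trans (permute-after-pair m<e e<r r↭s)
          (permute-after-pair m<e (All-resp-↭ r↭s e<r) s↭r′)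

-- A letter e smaller than c and all of p comes forward to stand next to m.  Of
-- the first two letters c and d behind m, the larger is moved in front of m,
-- which shortens the block between m and e.
fetch : ∀ {m e} c p {q} → m < e → All (e <_) (c ∷ p) → Unique (c ∷ p) →
        m ∷ c ∷ p ++ e ∷ q ~ m ∷ e ∷ c ∷ p ++ q
fetch c [] m<e (e<c ∷ []) _ = ~-sym (step⇒~ (comm m<e e<c))
fetch {m} {e} c (d ∷ p) {q} m<e (e<c ∷ e<d ∷ e<p) ((c≢d ∷ c∉p) ∷ d∉p ∷ p!) with <-cmp c d
... | tri> _ _ d<c = begin
  m ∷ c ∷ d ∷ p ++ e ∷ q    ≈⟨ step⇒~ (move (<-trans m<e e<d) d<c) ⟩
  c ∷ m ∷ d ∷ p ++ e ∷ q    ≈⟨ ~-++ˡ [ c ] (fetch d p m<e (e<d ∷ e<p) (d∉p ∷ p!)) ⟩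
  c ∷ m ∷ e ∷ d ∷ p ++ q    ≈⟨ pair-past-letter _ m<e e<c ⟩
  m ∷ e ∷ c ∷ d ∷ p ++ q    ∎
  where open ~-Reasoning
... | tri≈ _ c≡d _ = contradiction c≡d c≢d
... | tri< c<d _ _ = begin
  m ∷ c ∷ d ∷ p ++ e ∷ q    ≈⟨ step⇒~ (comm (<-trans m<e e<c) c<d) ⟩
  m ∷ d ∷ c ∷ p ++ e ∷ q    ≈⟨ step⇒~ (move (<-trans m<e e<c) c<d) ⟩
  d ∷ m ∷ c ∷ p ++ e ∷ q    ≈⟨ ~-++ˡ [ d ] (fetch c p m<e (e<c ∷ e<p) (c∉p ∷ p!)) ⟩
  d ∷ m ∷ e ∷ c ∷ p ++ q    ≈⟨ pair-past-letter _ m<e e<d ⟩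
  m ∷ e ∷ d ∷ c ∷ p ++ q    ≈⟨ ~-++ˡ [ m ] (swap-above _ e<d e<c) ⟩
  m ∷ e ∷ c ∷ d ∷ p ++ q    ∎
  where open ~-Reasoning

-- If e is the minimum of the tail z, the tail may be rearranged with e in front.
second-to-front : ∀ {m e z r} → m < e → All (e <_) r → Unique z → z ↭ e ∷ r →
                  m ∷ z ~ m ∷ e ∷ r
second-to-front {m} {e} {z} {r} m<e e<r z! z↭er
  with p , q , ≡.refl ← ∈-∃++ (∈-resp-↭ (↭-sym z↭er) (here ≡.refl)) =
  go p (unique-++ˡ p z!) (drop-mid p [] z↭er)
  where
  go : ∀ p → Unique p → p ++ q ↭ r → m ∷ p ++ e ∷ q ~ m ∷ e ∷ r
  go []      _  pq↭r = permute-after-pair m<e (All-resp-↭ (↭-sym pq↭r) e<r) pq↭r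
  go (c ∷ p) p! pq↭r = ~-trans (fetch c p m<e (All.++⁻ˡ (c ∷ p) e<pq) p!) (permute-after-pair m<e e<pq pq↭r)
    where e<pq = All-resp-↭ (↭-sym pq↭r) e<r

minimum : ∀ c z → Unique (c ∷ z) → ∃₂ λ e r → c ∷ z ↭ e ∷ r × All (e <_) r
minimum c [] _ = c , [] , refl , []
minimum c (d ∷ z) (c∉ ∷ z!) with e , r , z↭er , e<r ← minimum d z z! | <-cmp c e
... | tri< c<e _ _    = c , d ∷ z , refl ,
                        All-resp-↭ (↭-sym z↭er) (c<e ∷ All.map (<-trans c<e) e<r)
... | tri≈ _ ≡.refl _ = contradiction (∈-resp-↭ (↭-sym z↭er) (here ≡.refl)) (All.All¬⇒¬Any c∉)
... | tri> _ _ e<c    = e , c ∷ r , trans (prep c z↭er) (swap c e refl) , e<c ∷ e<r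

-- Everything to the right of a letter smaller than all of it permutes freely.
permute-after-min : ∀ {m z z′} → All (m <_) z → Unique z → z ↭ z′ → m ∷ z ~ m ∷ z′
permute-after-min {z = []} _ _ z↭z′ rewrite ↭-empty-inv (↭-sym z↭z′) = ~-refl
permute-after-min {z = c ∷ z} m<z z! z↭z′
  with e , r , z↭er , e<r ← minimum c z z!
  with m<e ∷ _ ← All-resp-↭ z↭er m<z =
  ~-trans (second-to-front m<e e<r z! z↭er)
          (~-sym (second-to-front m<e e<r (unique-↭ z↭z′ z!) (trans (↭-sym z↭z′) z↭er)))

-- The form used for the invariant: b is the least letter of the whole word and
-- occurs in u, so the part x behind u permutes freely.
permute-after : ∀ {b u x x′} → b ∈ u → Unique (u ++ x) → All (b ≤_) (u ++ x) → x ↭ x′ →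
                u ++ x ~ u ++ x′
permute-after {b} {u} {x} {x′} b∈u ux! b≤ux x↭x′
  with p , q , ≡.refl ← ∈-∃++ b∈u
  rewrite ++-assoc p (b ∷ q) x | ++-assoc p (b ∷ q) x′
  with b∉ ∷ qx! ← unique-++ʳ p ux! | _ ∷ b≤ ← All.++⁻ʳ p b≤ux =
  ~-++ˡ p (permute-after-min (All.zipWith (λ (b≤y , b≢y) → ≤∧≢⇒< b≤y b≢y) (b≤ , b∉)) qx! (++⁺ˡ q x↭x′))

-- Deleting letters, and the part of a word behind a letter

other? : ∀ a → Decidable (a ≢_)
other? a y = ¬? (a ≟ y)

-- Delete all occurrences of a letter.
delete : ℕ → List ℕ → List ℕ
delete a = filter (other? a)

-- The part of a word behind the first occurrence of a (empty if there is none).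
after : ℕ → List ℕ → List ℕ
after a []      = []
after a (y ∷ w) with a ≟ y
... | yes _ = w
... | no  _ = after a w

delete-∉ : ∀ {a w} → All (a ≢_) w → delete a w ≡ w
delete-∉ {a} = filter-all (other? a)

delete-++ : ∀ a u x → delete a (u ++ x) ≡ delete a u ++ delete a x
delete-++ a = filter-++ (other? a)

delete-∷ : ∀ a x → delete a (a ∷ x) ≡ delete a x
delete-∷ a x = filter-reject (other? a) {a} {x} (λ a≢a → a≢a ≡.refl)

delete-split : ∀ {a u x} → All (a <_) u → All (a <_) x → delete a (u ++ a ∷ x) ≡ u ++ x
delete-split {a} {u} {x} a<u a<x
  rewrite delete-++ a u (a ∷ x) | delete-∷ a x
        | delete-∉ (All.map <⇒≢ a<u) | delete-∉ (All.map <⇒≢ a<x) = ≡.refl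

after-split : ∀ {a} u {x} → All (a <_) u → after a (u ++ a ∷ x) ≡ x
after-split {a} [] _ with a ≟ a
... | yes _  = ≡.refl
... | no a≢a = contradiction ≡.refl a≢a
after-split {a} (y ∷ u) (a<y ∷ a<u) with a ≟ y
... | yes ≡.refl = contradiction a<y (<-irrefl ≡.refl)
... | no _       = after-split u a<u

delete-↭ : ∀ {e z} → e ∈ z → Unique z → z ↭ e ∷ delete e z
delete-↭ {e} e∈z z! with p , q , ≡.refl ← ∈-∃++ e∈z
  with e∉ ← unique-↭ (shift e p q) z!
  rewrite delete-++ e p (e ∷ q) | delete-∷ e q
  with e∉pq ∷ _ ← e∉
  rewrite delete-∉ (All.++⁻ˡ p e∉pq) | delete-∉ (All.++⁻ʳ p e∉pq) = shift e p q

-- Increasing vectors of letters, and the least letter occurring in a word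

-- The alphabet of a word of distinct letters is given as an increasing vector.
Increasing : ∀ {n} → Vec ℕ n → Set
Increasing V = AllPairs _<_ (toList V)

removeAt-increasing : ∀ {n} (V : Vec ℕ (suc n)) i → Increasing V → Increasing (removeAt V i)
removeAt-increasing (x ∷ V)         zero    (_ ∷ V↗)   = V↗
removeAt-increasing (x ∷ V@(_ ∷ _)) (suc i) (x<V ∷ V↗) =
  removeAt-All V i x<V ∷ removeAt-increasing V i V↗

increasing⇒unique : ∀ {n} {V : Vec ℕ n} → Increasing V → Unique (toList V)
increasing⇒unique = AllPairs.map <⇒≢

-- The index of the first entry of V that occurs in x; for increasing V and a
-- nonempty word x in letters of V this is the position of the minimum of x.
first : ∀ {n} → Vec ℕ n → List ℕ → Maybe (Fin n)
first []      x = nothing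
first (l ∷ V) x with l ∈? x
... | yes _ = just zero
... | no  _ = Maybe.map suc (first V x)

first-nothing : ∀ {n} (V : Vec ℕ n) {x} → first V x ≡ nothing → All (_∉ x) (toList V)
first-nothing []      _  = []
first-nothing (l ∷ V) {x} eq with l ∈? x
... | no l∉x with first V x in eq′
...   | nothing = l∉x ∷ first-nothing V eq′

first-∈ : ∀ {n} (V : Vec ℕ n) {x i} → first V x ≡ just i → lookup V i ∈ x
first-∈ (l ∷ V) {x} eq with l ∈? x
first-∈ (l ∷ V) {x} ≡.refl | yes l∈x = l∈x
first-∈ (l ∷ V) {x} eq     | no _ with first V x in eq′
first-∈ (l ∷ V) {x} ≡.refl | no _ | just _ = first-∈ V eq′

first-min : ∀ {n} (V : Vec ℕ n) {x i y} → Increasing V → first V x ≡ just i →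
            y ∈ toList V → y ∈ x → lookup V i ≤ y
first-min (l ∷ V) {x} _ eq _ _ with l ∈? x
first-min (l ∷ V) {x} _          ≡.refl (here ≡.refl) _   | yes _  = ≤-refl
first-min (l ∷ V) {x} (l<V ∷ _)  ≡.refl (there y∈V)   _   | yes _  = <⇒≤ (All.lookup l<V y∈V)
first-min (l ∷ V) {x} _          eq     (here ≡.refl) y∈x | no l∉x = contradiction y∈x l∉x
first-min (l ∷ V) {x} (_ ∷ V↗)   eq     (there y∈V)   y∈x | no _ with first V x in eq′
first-min (l ∷ V) {x} (_ ∷ V↗)   ≡.refl (there y∈V)   y∈x | no _ | just _ = first-min V V↗ eq′ y∈V y∈x

first-head : ∀ {n l} (V : Vec ℕ n) {x} → l ∈ x → first (l ∷ V) x ≡ just zero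
first-head {l = l} V {x} l∈x with l ∈? x
... | yes _   = ≡.refl
... | no l∉x  = contradiction l∈x l∉x

first-tail : ∀ {n l} (V : Vec ℕ n) {x} → l ∉ x → first (l ∷ V) x ≡ Maybe.map suc (first V x)
first-tail {l = l} V {x} l∉x with l ∈? x
... | yes l∈x = contradiction l∈x l∉x
... | no _    = ≡.refl

first-∷-cong : ∀ {n l} (V : Vec ℕ n) {x x′} → (l ∈ x → l ∈ x′) → (l ∈ x′ → l ∈ x) →
               first V x ≡ first V x′ → first (l ∷ V) x ≡ first (l ∷ V) x′
first-∷-cong {l = l} V {x} {x′} f g eq with l ∈? x | l ∈? x′
... | yes _   | yes _    = ≡.refl
... | no _    | no _     = cong (Maybe.map suc) eq
... | yes l∈x | no l∉x′  = contradiction (f l∈x) l∉x′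
... | no l∉x  | yes l∈x′ = contradiction (g l∈x′) l∉x

first-cong : ∀ {n} (V : Vec ℕ n) {x x′} → (∀ {y} → y ∈ x → y ∈ x′) → (∀ {y} → y ∈ x′ → y ∈ x) →
             first V x ≡ first V x′
first-cong []      _ _ = ≡.refl
first-cong (l ∷ V) f g = first-∷-cong V f g (first-cong V f g)

-- Dropping a letter c leaves the minimum unchanged if a smaller letter y remains.
first-drop : ∀ {n} (V : Vec ℕ n) {c y q} → Increasing V → y ∈ toList V → y < c →
             first V (c ∷ y ∷ q) ≡ first V (y ∷ q)
first-drop (l ∷ V) _ (here ≡.refl) _ =
  ≡.trans (first-head {l = l} V (there (here ≡.refl))) (sym (first-head {l = l} V (here ≡.refl)))
first-drop (l ∷ V) (l<V ∷ V↗) (there y∈V) y<c =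
  first-∷-cong V
    (λ { (here l≡c) → contradiction l≡c (<⇒≢ (<-trans (All.lookup l<V y∈V) y<c))
       ; (there l∈) → l∈ })
    there (first-drop V V↗ y∈V y<c)

first-[] : ∀ {n} (V : Vec ℕ n) → first V [] ≡ nothing
first-[] []      = ≡.refl
first-[] (l ∷ V) = cong (Maybe.map suc) (first-[] V)

first-lookup : ∀ {n} (V : Vec ℕ n) i → Increasing V → first V [ lookup V i ] ≡ just i
first-lookup (l ∷ V) zero    _ = first-head {l = l} V (here ≡.refl)
first-lookup (l ∷ V) (suc i) (l<V ∷ V↗) =
  ≡.trans (first-tail V λ { (here l≡) → <⇒≢ (All.lookup l<V (lookup-∈ V i)) l≡ })
          (cong (Maybe.map suc) (first-lookup V i V↗))

-- The code of a word

-- Codes of the classes of words in n distinct letters.  For n + 2 letters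
-- a < b < ...: a stands last, and the rest has a code; or the least letter
-- behind a is one of the n letters above b, and the word without a and that
-- letter has a code; or b stands behind a.
Code : ℕ → Set
Code zero          = ⊤
Code (suc zero)    = ⊤
Code (suc (suc n)) = (Code (suc n) ⊎ (Fin n × Code n)) ⊎ ⊤

-- The code of a word in letters a < b < ..., from the minimum m of the part
-- behind a (as an index among the letters other than a) and the word y without
-- a.  The maps f and g encode the words with fewer letters; they are
-- arguments here so that the recursion in code stays structural.
branch : ∀ {n} → (List ℕ → Code (suc n)) → (Fin n → List ℕ → Code n) →
         Maybe (Fin (suc n)) → List ℕ → Code (suc (suc n))
branch f g nothing        y = inj₁ (inj₁ (f y))
branch f g (just zero)    y = inj₂ tt
branch f g (just (suc i)) y = inj₁ (inj₂ (i , g i y))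

-- The code of a word whose letters are those of the increasing vector V.
code : ∀ n → Vec ℕ n → List ℕ → Code n
code zero          _       _ = tt
code (suc zero)    _       _ = tt
code (suc (suc n)) (a ∷ V) w =
  branch (code (suc n) V)
         (λ i → code n (removeAt V (suc i)) ∘ delete (lookup V (suc i)))
         (first V (after a w)) (delete a w)

-- The recursive step of code as a function of the minimum behind a and of the
-- word without a.
refine : ∀ {n} → Vec ℕ (suc n) → Maybe (Fin (suc n)) → List ℕ → Code (suc (suc n))
refine {n} V = branch (code (suc n) V) (λ i → code n (removeAt V (suc i)) ∘ delete (lookup V (suc i)))

-- Steps preserve the code

-- What a step can do to a word u a x in which a is smaller than all letters of
-- u.  In cross the letter a moves right over c.
data Effect (a : ℕ) : (u x w′ : List ℕ) → Set where
  before : ∀ {u u′ x} → Step u u′ → Effect a u x (u′ ++ a ∷ x)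
  behind : ∀ {u x x′} → x ↭ x′ → Effect a u x (u ++ a ∷ x′)
  cross  : ∀ {u c y q} → y < c → Effect a u (c ∷ y ∷ q) (u ++ c ∷ a ∷ y ∷ q)

effect-∷ : ∀ {a u x w′} h → Effect a u x w′ → Effect a (h ∷ u) x (h ∷ w′)
effect-∷ h (before s)   = before (there s)
effect-∷ h (behind x↭)  = behind x↭
effect-∷ h (cross y<c)  = cross y<c

-- In the factors xyz and xzy that a step replaces the least letter stands
-- first.  So a factor containing a starts with a; the clauses in which it
-- starts with letters of u and reaches a are absurd.
effect : ∀ {a} u {x w′} → All (a <_) u → Step (u ++ a ∷ x) w′ → Effect a u x w′
effect []      _ (comm _ _)   = behind (swap _ _ refl)
effect []      _ (move _ y<z) = cross y<z
effect []      _ (there s)    = behind (step⇒↭ s)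
effect (h ∷ []) (a<h ∷ _) (comm h<a _)   = contradiction h<a (<-asym a<h)
effect (h ∷ []) (a<h ∷ _) (move h<y y<a) = contradiction (<-trans h<y y<a) (<-asym a<h)
effect (h ∷ k ∷ []) (a<h ∷ _) (comm h<k k<a) = contradiction (<-trans h<k k<a) (<-asym a<h)
effect (h ∷ k ∷ []) (a<h ∷ _) (move h<a _)   = contradiction h<a (<-asym a<h)
effect (h ∷ k ∷ l ∷ u) _ (comm h<k k<l) = before (comm h<k k<l)
effect (h ∷ k ∷ l ∷ u) _ (move h<l l<k) = before (move h<l l<k)
effect (h ∷ u) (_ ∷ a<u) (there s) = effect-∷ h (effect u a<u s)

-- A word in the letters a and V, cut at its least letter a.
record Split (a : ℕ) (V : List ℕ) (w : List ℕ) : Set where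
  constructor split
  field
    {left right} : List ℕ
    word         : w ≡ left ++ a ∷ right
    a<left       : All (a <_) left
    a<right      : All (a <_) right
    rest         : left ++ right ↭ V

splitAt-min : ∀ {a V w} → All (a <_) V → w ↭ a ∷ V → Split a V w
splitAt-min {a} a<V w↭ with u , x , ≡.refl ← ∈-∃++ (∈-resp-↭ (↭-sym w↭) (here ≡.refl)) =
  split ≡.refl (All.++⁻ˡ u a<ux) (All.++⁻ʳ u a<ux) ux↭V
  where
  ux↭V = drop-mid u [] w↭
  a<ux = All-resp-↭ (↭-sym ux↭V) a<V

-- The recursion for code on a word cut at its least letter.
code-split : ∀ {n a u x} (V : Vec ℕ (suc n)) → All (a <_) u → All (a <_) x →
             code (suc (suc n)) (a ∷ V) (u ++ a ∷ x) ≡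
             refine V (first V x) (u ++ x)
code-split {u = u} V a<u a<x =
  cong₂ (λ x y → refine V (first V x) y) (after-split u a<u) (delete-split a<u a<x)

refine-cong : ∀ {n} (V : Vec ℕ (suc n)) m {y y′} →
              (m ≡ nothing → code (suc n) V y ≡ code (suc n) V y′) →
              (∀ {i} → m ≡ just (suc i) →
                 code n (removeAt V (suc i)) (delete (lookup V (suc i)) y) ≡
                 code n (removeAt V (suc i)) (delete (lookup V (suc i)) y′)) →
              refine V m y ≡ refine V m y′
refine-cong V nothing        eq₁ eq₂ = cong (inj₁ ∘ inj₁) (eq₁ ≡.refl)
refine-cong V (just zero)    eq₁ eq₂ = ≡.refl
refine-cong V (just (suc i)) eq₁ eq₂ = cong (λ c → inj₁ (inj₂ (i , c))) (eq₂ ≡.refl)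

-- A function invariant under steps between words with content V is invariant
-- under the generated equivalence.
~-invariant : ∀ {A : Set} {f : List ℕ → A} {V : List ℕ} →
              (∀ {w w′} → w ↭ V → Step w w′ → f w ≡ f w′) →
              ∀ {w w′} → w ↭ V → w ~ w′ → f w ≡ f w′
~-invariant {f = f} {V} inv w↭V w~w′ = proj₂ (Eq.fold equiv step′ w~w′) w↭V
  where
  R : Rel (List ℕ) 0ℓ
  R w w′ = w ↭ w′ × (w ↭ V → f w ≡ f w′)
  equiv : IsEquivalence R
  equiv = record
    { refl  = refl , λ _ → ≡.refl
    ; sym   = λ (p , e) → ↭-sym p , λ q → sym (e (trans p q))
    ; trans = λ (p , e) (p′ , e′) → trans p p′ , λ q → ≡.trans (e q) (e′ (trans (↭-sym p) q))
    }
  step′ : ∀ {w w′} → Step w w′ → R w w′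
  step′ s = step⇒↭ s , λ q → inv q s

-- Deleting the i-th letter from a word in the letters V.
delete-first-↭ : ∀ {n V y} (i : Fin (suc n)) → Increasing V → y ↭ toList V →
                 delete (lookup V i) y ↭ toList (removeAt V i)
delete-first-↭ {V = V} i V↗ y↭V =
  drop-∷ (trans (↭-sym (delete-↭ (∈-resp-↭ (↭-sym y↭V) (lookup-∈ V i))
                                 (unique-↭ (↭-sym y↭V) (increasing⇒unique V↗))))
                (trans y↭V (removeAt-↭ V i)))

-- On words in the letters V, the code is invariant under steps, respectively
-- under the generated equivalence.
RespectsSteps : ∀ n → Vec ℕ n → Set
RespectsSteps n V = ∀ {w w′} → w ↭ toList V → Step w w′ → code n V w ≡ code n V w′

Respects~ : ∀ n → Vec ℕ n → Set
Respects~ n V = ∀ {w w′} → w ↭ toList V → w ~ w′ → code n V w ≡ code n V w′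

-- The induction step: the hypotheses say that the codes of the words without a,
-- and of the words without a and one further letter, are invariant.
code-step : ∀ n {a} (V : Vec ℕ (suc n)) → Increasing (a ∷ V) →
            Respects~ (suc n) V → (∀ i → Respects~ n (removeAt V (suc i))) →
            RespectsSteps (suc (suc n)) (a ∷ V)
code-step n {a} V@(b ∷ _) (a<V ∷ V↗@(b<L ∷ _)) ih₁ ih₂ w↭ s
  with split {u} {x} ≡.refl a<u a<x ux↭ ← splitAt-min a<V w↭
  with effect u a<u s
... | cross {c = c} {y} {q} y<c = begin
  code _ (a ∷ V) (u ++ a ∷ c ∷ y ∷ q)           ≡⟨ code-split V a<u a<x ⟩
  refine V (first V (c ∷ y ∷ q)) (u ++ c ∷ y ∷ q)
    ≡⟨ cong₂ (refine V) (first-drop V V↗ y∈V y<c) (sym (++-assoc u [ c ] (y ∷ q))) ⟩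
  refine V (first V (y ∷ q)) ((u ++ [ c ]) ++ y ∷ q)
    ≡⟨ code-split V (All.++⁺ a<u (All.head a<x ∷ [])) (All.tail a<x) ⟨
  code _ (a ∷ V) ((u ++ [ c ]) ++ a ∷ y ∷ q)    ≡⟨ cong (code _ (a ∷ V)) (++-assoc u [ c ] (a ∷ y ∷ q)) ⟩
  code _ (a ∷ V) (u ++ c ∷ a ∷ y ∷ q)           ∎
  where
  open ≡.≡-Reasoning
  y∈V = ∈-resp-↭ ux↭ (∈-++⁺ʳ u (there (here ≡.refl)))
... | before {u′ = u′} s′ =
  ≡.trans (code-split V a<u a<x) (≡.trans
  (refine-cong V (first V x)
    (λ _ → ih₁ ux↭ (step⇒~ (step-++ʳ x s′)))
    (λ {i} eq → ih₂ i (delete-first-↭ (suc i) V↗ ux↭) (step⇒~ (deleted (first-∈ V eq)))))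
  (sym (code-split V (All-resp-↭ (step⇒↭ s′) a<u) a<x)))
  where
  ux! = unique-↭ (↭-sym ux↭) (increasing⇒unique {V = V} V↗)
  deleted : ∀ {e} → e ∈ x → Step (delete e (u ++ x)) (delete e (u′ ++ x))
  deleted {e} e∈x = subst₂ Step (eq e∉u) (eq (All-resp-↭ (step⇒↭ s′) e∉u)) (step-++ʳ (delete e x) s′)
    where
    e∉u = unique-disjoint u ux! e∈x
    eq : ∀ {v} → All (e ≢_) v → v ++ delete e x ≡ delete e (v ++ x)
    eq {v} e∉v = ≡.trans (cong (_++ delete e x) (sym (delete-∉ e∉v))) (sym (delete-++ e v x))
... | behind {x′ = x′} x↭ =
  ≡.trans (code-split V a<u a<x) (≡.trans
  (refine-cong V (first V x)
    (λ eq → ih₁ ux↭ (permute-after (b∈u (All.head (first-nothing V eq))) ux! b≤ x↭))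
    (λ {i} eq → ih₂ i (delete-first-↭ (suc i) V↗ ux↭) (deleted i eq)))
  (≡.trans (cong (λ m → refine V m (u ++ x′)) (first-cong V (∈-resp-↭ x↭) (∈-resp-↭ (↭-sym x↭))))
  (sym (code-split V a<u (All-resp-↭ x↭ a<x)))))
  where
  ux! = unique-↭ (↭-sym ux↭) (increasing⇒unique {V = V} V↗)
  b≤ = All-resp-↭ (↭-sym ux↭) (≤-refl ∷ All.map <⇒≤ b<L)
  b∈u : b ∉ x → b ∈ u
  b∈u b∉x with ∈-++⁻ u (∈-resp-↭ (↭-sym ux↭) (here ≡.refl))
  ... | inj₁ b∈u = b∈u
  ... | inj₂ b∈x = contradiction b∈x b∉x
  deleted : ∀ i → first V x ≡ just (suc i) →
            delete (lookup V (suc i)) (u ++ x) ~ delete (lookup V (suc i)) (u ++ x′)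
  deleted i eq = subst₂ _~_ (sym (delete-++ e u x)) (sym (delete-++ e u x′))
    (permute-after (∈-filter⁺ (other? e) (b∈u b∉x) (λ e≡b → <⇒≢ b<e (sym e≡b)))
       (subst Unique (delete-++ e u x) (Unique.filter⁺ (other? e) ux!))
       (subst (All (b ≤_)) (delete-++ e u x) (All.filter⁺ (other? e) b≤))
       (filter-↭ (other? e) x↭))
    where
    e = lookup V (suc i)
    b<e : b < e
    b<e = All.lookup b<L (lookup-∈ _ i)
    b∉x : b ∉ x
    b∉x b∈x = <⇒≱ b<e (first-min V V↗ eq (here ≡.refl) b∈x)

code-~ : ∀ n (V : Vec ℕ n) → Increasing V → Respects~ n V
code-~ zero          V       _           _ _ = ≡.refl
code-~ (suc zero)    V       _           _ _ = ≡.refl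
code-~ (suc (suc n)) (a ∷ V) aV↗@(_ ∷ V↗) =
  ~-invariant (code-step n V aV↗ (code-~ (suc n) V V↗)
    (λ i → code-~ n (removeAt V (suc i)) (removeAt-increasing V (suc i) V↗)))

-- A representative of each class

-- A word with the given code.  If a letter above b is prescribed as the least
-- one behind a, it is the only letter behind a.
decode : ∀ n → Vec ℕ n → Code n → List ℕ
decode zero          _       _                     = []
decode (suc zero)    (a ∷ _) _                     = [ a ]
decode (suc (suc n)) (a ∷ V) (inj₁ (inj₁ c))       = decode (suc n) V c ++ [ a ]
decode (suc (suc n)) (a ∷ V) (inj₁ (inj₂ (i , c))) =
  decode n (removeAt V (suc i)) c ++ a ∷ [ lookup V (suc i) ]
decode (suc (suc n)) (a ∷ V) (inj₂ _)              = a ∷ toList V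

decode-↭ : ∀ n (V : Vec ℕ n) c → decode n V c ↭ toList V
decode-↭ zero          []        _                     = refl
decode-↭ (suc zero)    (a ∷ [])  _                     = refl
decode-↭ (suc (suc n)) (a ∷ V)   (inj₁ (inj₁ c))       =
  trans (↭-sym (∷↭∷ʳ a _)) (prep a (decode-↭ (suc n) V c))
decode-↭ (suc (suc n)) (a ∷ V)   (inj₁ (inj₂ (i , c))) =
  trans (++-comm (decode n (removeAt V (suc i)) c) _) (prep a
    (trans (prep _ (decode-↭ n _ c)) (↭-sym (removeAt-↭ V (suc i)))))
decode-↭ (suc (suc n)) (a ∷ V)   (inj₂ _)              = refl

code-decode : ∀ n (V : Vec ℕ n) → Increasing V → ∀ c → code n V (decode n V c) ≡ c
code-decode zero          V       _  _ = ≡.refl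
code-decode (suc zero)    V       _  _ = ≡.refl
code-decode (suc (suc n)) (a ∷ V) (a<V ∷ V↗) (inj₁ (inj₁ c)) = begin
  code _ (a ∷ V) (u ++ [ a ])        ≡⟨ code-split V (All-resp-↭ (↭-sym (decode-↭ _ V c)) a<V) [] ⟩
  refine V (first V []) (u ++ [])    ≡⟨ cong₂ (refine V) (first-[] V) (++-identityʳ u) ⟩
  inj₁ (inj₁ (code (suc n) V u))     ≡⟨ cong (inj₁ ∘ inj₁) (code-decode (suc n) V V↗ c) ⟩
  inj₁ (inj₁ c)                      ∎
  where
  open ≡.≡-Reasoning
  u = decode (suc n) V c
code-decode (suc (suc n)) (a ∷ V) (a<V ∷ V↗) (inj₁ (inj₂ (i , c))) = begin
  code _ (a ∷ V) (u ++ a ∷ [ e ])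
    ≡⟨ code-split V (All-resp-↭ (↭-sym (decode-↭ _ V′ c)) (removeAt-All V (suc i) a<V))
                    (All.lookup a<V (lookup-∈ V (suc i)) ∷ []) ⟩
  refine V (first V [ e ]) (u ++ [ e ])
    ≡⟨ cong (λ m → refine V m (u ++ [ e ])) (first-lookup V (suc i) V↗) ⟩
  inj₁ (inj₂ (i , code n V′ (delete e (u ++ [ e ]))))
    ≡⟨ cong (λ y → inj₁ (inj₂ (i , code n V′ y))) deleted ⟩
  inj₁ (inj₂ (i , code n V′ u))
    ≡⟨ cong (λ c → inj₁ (inj₂ (i , c))) (code-decode n V′ (removeAt-increasing V (suc i) V↗) c) ⟩
  inj₁ (inj₂ (i , c)) ∎
  where
  open ≡.≡-Reasoning
  V′ = removeAt V (suc i)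
  u = decode n V′ c
  e = lookup V (suc i)
  e∉u : All (e ≢_) u
  e∉u with e∉ ∷ _ ← unique-↭ (removeAt-↭ V (suc i)) (increasing⇒unique {V = V} V↗) =
    All-resp-↭ (↭-sym (decode-↭ n V′ c)) e∉
  deleted : delete e (u ++ [ e ]) ≡ u
  deleted = ≡.trans (delete-++ e u [ e ])
    (≡.trans (cong₂ _++_ (delete-∉ e∉u) (delete-∷ e [])) (++-identityʳ u))
code-decode (suc (suc n)) (a ∷ V@(b ∷ L)) (a<V ∷ _) (inj₂ tt) =
  ≡.trans (code-split V [] a<V) (cong (λ m → refine V m (toList V)) (first-head {l = b} L (here ≡.refl)))

delete-min : ∀ {e x} → All (e ≤_) x → All (e <_) (delete e x)
delete-min {e} {x} e≤x = All.zipWith (λ (e≤y , e≢y) → ≤∧≢⇒< e≤y e≢y)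
  (All.filter⁺ (other? e) e≤x , All.all-filter (other? e) x)

-- Bring the minimum e of x next to a.
fetch-min : ∀ {a e x} → a < e → e ∈ x → All (e ≤_) x → Unique x → a ∷ x ~ a ∷ e ∷ delete e x
fetch-min a<e e∈x e≤x x! =
  second-to-front a<e (delete-min e≤x) x! (delete-↭ e∈x x!)

-- Words in the letters V are equivalent to the representative of their code.
Decoded : ∀ n → Vec ℕ n → Set
Decoded n V = ∀ {w} → w ↭ toList V → w ~ decode n V (code n V w)

-- For w = u a x: if x is empty, use induction on u.  If b is in x, fetch b next
-- to a, move the pair a b to the front and sort the rest.  Otherwise fetch the
-- minimum e of x, move the pair a e to the end, and use induction on the rest.
~-decode-step : ∀ n {a} (V : Vec ℕ (suc n)) → Increasing (a ∷ V) →
                Decoded (suc n) V → (∀ i → Decoded n (removeAt V (suc i))) →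
                Decoded (suc (suc n)) (a ∷ V)
~-decode-step n {a} V@(b ∷ L) (a<V ∷ V↗@(b<L ∷ _)) ih₁ ih₂ w↭
  with split {u} {x} ≡.refl a<u a<x ux↭ ← splitAt-min a<V w↭ =
  subst (λ c → u ++ a ∷ x ~ decode (suc (suc n)) (a ∷ V) c) (sym (code-split V a<u a<x)) (go (first V x) ≡.refl)
  where
  ux! = unique-↭ (↭-sym ux↭) (increasing⇒unique {V = V} V↗)
  x!  = unique-++ʳ u ux!
  b≤x = All.++⁻ʳ u (All-resp-↭ (↭-sym ux↭) (≤-refl ∷ All.map <⇒≤ b<L))
  go : ∀ m → first V x ≡ m → u ++ a ∷ x ~ decode (suc (suc n)) (a ∷ V) (refine V m (u ++ x))
  -- No letter of V occurs in x, so x is empty.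
  go nothing        eq = last-case x ux↭ (first-nothing V eq)
    where
    last-case : ∀ x → u ++ x ↭ toList V → All (_∉ x) (toList V) →
                u ++ a ∷ x ~ decode (suc n) V (code (suc n) V (u ++ x)) ++ [ a ]
    last-case [] ux↭ _ =
      subst (λ y → u ++ [ a ] ~ decode (suc n) V (code (suc n) V y) ++ [ a ]) (sym (++-identityʳ u))
        (~-++ʳ [ a ] (ih₁ (subst (_↭ toList V) (++-identityʳ u) ux↭)))
    last-case (y ∷ x) ux↭ ∉x =
      contradiction (here ≡.refl) (All.lookup ∉x (∈-resp-↭ ux↭ (∈-++⁺ʳ u (here ≡.refl))))
  go (just zero)    eq = begin
    u ++ a ∷ x       ≈⟨ ~-++ˡ u (fetch-min (All.head a<V) b∈x b≤x x!) ⟩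
    u ++ a ∷ b ∷ x′  ≈⟨ pair-past u (All.head a<V) (All.++⁻ˡ u b<ux′) ⟩
    a ∷ b ∷ u ++ x′  ≈⟨ permute-after-pair (All.head a<V) b<ux′ ux′↭L ⟩
    a ∷ toList V     ∎
    where
    open ~-Reasoning
    x′    = delete b x
    b∈x   = first-∈ V eq
    ux′↭L = drop-mid u [] (trans (++⁺ˡ u (↭-sym (delete-↭ b∈x x!))) ux↭)
    b<ux′ = All-resp-↭ (↭-sym ux′↭L) b<L
  go (just (suc i)) eq = begin
    u ++ a ∷ x               ≈⟨ ~-++ˡ u (fetch-min a<e e∈x e≤x x!) ⟩
    u ++ a ∷ e ∷ x′          ≡⟨ cong (λ y → u ++ a ∷ e ∷ y) (++-identityʳ x′) ⟨
    u ++ a ∷ e ∷ x′ ++ []    ≈⟨ ~-++ˡ u (pair-past x′ a<e e<x′) ⟨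
    u ++ x′ ++ a ∷ [ e ]     ≡⟨ ++-assoc u x′ (a ∷ [ e ]) ⟨
    (u ++ x′) ++ a ∷ [ e ]   ≡⟨ cong (_++ a ∷ [ e ]) deleted ⟨
    delete e (u ++ x) ++ a ∷ [ e ]
      ≈⟨ ~-++ʳ _ (ih₂ i (delete-first-↭ (suc i) V↗ ux↭)) ⟩
    decode n (removeAt V (suc i)) (code n (removeAt V (suc i)) (delete e (u ++ x))) ++ a ∷ [ e ] ∎
    where
    open ~-Reasoning
    e   = lookup V (suc i)
    x′  = delete e x
    e∈x = first-∈ V eq
    a<e = All.lookup a<V (lookup-∈ V (suc i))
    e≤x : All (e ≤_) x
    e≤x = All.tabulate (λ y∈x → first-min V V↗ eq (∈-resp-↭ ux↭ (∈-++⁺ʳ u y∈x)) y∈x)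
    e<x′ = delete-min e≤x
    deleted : delete e (u ++ x) ≡ u ++ x′
    deleted = ≡.trans (delete-++ e u x) (cong (_++ x′) (delete-∉ (unique-disjoint u ux! e∈x)))

~-decode : ∀ n (V : Vec ℕ n) → Increasing V → Decoded n V
~-decode zero          []        _ w↭ = ~-reflexive (↭-empty-inv w↭)
~-decode (suc zero)    (a ∷ [])  _ w↭ = ~-reflexive (↭-singleton-inv w↭)
~-decode (suc (suc n)) (a ∷ V) aV↗@(_ ∷ V↗) =
  ~-decode-step n V aV↗ (~-decode (suc n) V V↗)
    (λ i → ~-decode n (removeAt V (suc i)) (removeAt-increasing V (suc i) V↗))

-- Replacements of the partition are steps, and conversely

module _ {A : Set} {P Q : A → Set} (P? : Decidable P) (Q? : Decidable Q) where

  filter-length-mono : (∀ {y} → P y → Q y) → ∀ w → length (filter P? w) ≤ length (filter Q? w)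
  filter-length-mono P⊆Q w = length-mono-≤ (filter⁺ P? Q? (λ { ≡.refl → P⊆Q }) (⊆-refl {x = w}))

  filter-length-strict : (∀ {y} → P y → Q y) → ∀ {x w} → x ∈ w → ¬ P x → Q x →
                         length (filter P? w) < length (filter Q? w)
  filter-length-strict P⊆Q {x} {_ ∷ w} (here ≡.refl) ¬Px Qx with P? x | Q? x
  ... | yes Px | _      = contradiction Px ¬Px
  ... | no _   | yes _  = s≤s (filter-length-mono P⊆Q w)
  ... | no _   | no ¬Qx = contradiction Qx ¬Qx
  filter-length-strict P⊆Q {x} {y ∷ w} (there x∈w) ¬Px Qx with P? y | Q? y
  ... | yes _  | yes _  = s<s (filter-length-strict P⊆Q x∈w ¬Px Qx)
  ... | yes Py | no ¬Qy = contradiction (P⊆Q Py) ¬Qy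
  ... | no _   | yes _  = m≤n⇒m≤1+n (filter-length-strict P⊆Q x∈w ¬Px Qx)
  ... | no _   | no _   = filter-length-strict P⊆Q x∈w ¬Px Qx

  filter-length-cong : ∀ {c} (u v : Vec A c) → (∀ i → P (lookup u i) ⇔ Q (lookup v i)) →
                       length (filter P? (toList u)) ≡ length (filter Q? (toList v))
  filter-length-cong []      []      _ = ≡.refl
  filter-length-cong (x ∷ u) (y ∷ v) iff with P? x | Q? y
  ... | yes _  | yes _  = cong suc (filter-length-cong u v (iff ∘ suc))
  ... | no _   | no _   = filter-length-cong u v (iff ∘ suc)
  ... | yes Px | no ¬Qy = contradiction (Equivalence.to (iff zero) Px) ¬Qy
  ... | no ¬Px | yes Qy = contradiction (Equivalence.from (iff zero) Qy) ¬Px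

-- The number of letters of w smaller than x.
rank : ℕ → List ℕ → ℕ
rank x w = length (filter (_<? x) w)

rank-strict : ∀ {x y w} → x ∈ w → x < y → rank x w < rank y w
rank-strict {x} {y} x∈w x<y =
  filter-length-strict (_<? x) (_<? y) (λ z<x → <-trans z<x x<y) x∈w (<-irrefl ≡.refl) x<y

-- An arrangement of given letters is determined by its order: entries in the
-- same place have equally many smaller entries, hence agree.
same-order⇒≡ : ∀ {c} (u v : Vec ℕ c) → toList u ↭ toList v →
               (∀ i j → lookup u i < lookup u j ⇔ lookup v i < lookup v j) → u ≡ v
same-order⇒≡ u v u↭v iff = Pointwise-≡⇒≡ (ext eq)
  where
  same-rank : ∀ i → rank (lookup u i) (toList u) ≡ rank (lookup v i) (toList u)
  same-rank i = ≡.trans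
    (filter-length-cong (_<? lookup u i) (_<? lookup v i) u v (λ j → iff j i))
    (↭-length (filter-↭ (_<? lookup v i) (↭-sym u↭v)))
  eq : ∀ i → lookup u i ≡ lookup v i
  eq i with <-cmp (lookup u i) (lookup v i)
  ... | tri< u<v _ _ = contradiction (same-rank i) (<⇒≢ (rank-strict (lookup-∈ u i) u<v))
  ... | tri≈ _ u≡v _ = u≡v
  ... | tri> _ _ v<u = contradiction (sym (same-rank i))
          (<⇒≢ (rank-strict (∈-resp-↭ (↭-sym u↭v) (lookup-∈ v i)) v<u))

-- The only part of size greater than one.
block : List (Vec ℕ 3)
block = (1 ∷ 2 ∷ 3 ∷ []) ∷ (1 ∷ 3 ∷ 2 ∷ []) ∷ (3 ∷ 1 ∷ 2 ∷ []) ∷ []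

-- The word w lists the entries of u in increasing order and is equivalent to u.
SortsTo : Vec ℕ 3 → List ℕ → Set
SortsTo u w = AllPairs _<_ w × toList u ~ w

-- A factor whose order permutation is in the block is equivalent to its
-- increasing rearrangement; so any two such factors in the same letters are
-- equivalent.
block-sorts : ∀ {σ u} → σ ∈ block → σ IsOrderPermOf u → ∃ (SortsTo u)
block-sorts {u = x ∷ y ∷ z ∷ []} (here ≡.refl) (_ , iff) =
  _ , (x<y ∷ <-trans x<y y<z ∷ []) ∷ (y<z ∷ []) ∷ [] ∷ [] , ~-refl
  where
  x<y = Equivalence.to (iff 0F 1F) (s<s z<s)
  y<z = Equivalence.to (iff 1F 2F) (s<s (s<s z<s))
block-sorts {u = x ∷ z ∷ y ∷ []} (there (here ≡.refl)) (_ , iff) =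
  _ , (x<y ∷ <-trans x<y y<z ∷ []) ∷ (y<z ∷ []) ∷ [] ∷ [] , ~-sym (step⇒~ (comm x<y y<z))
  where
  x<y = Equivalence.to (iff 0F 2F) (s<s z<s)
  y<z = Equivalence.to (iff 2F 1F) (s<s (s<s z<s))
block-sorts {u = z ∷ x ∷ y ∷ []} (there (there (here ≡.refl))) (_ , iff) =
  _ , (x<y ∷ <-trans x<y y<z ∷ []) ∷ (y<z ∷ []) ∷ [] ∷ [] , pair-past-letter [] x<y y<z
  where
  x<y = Equivalence.to (iff 1F 2F) (s<s z<s)
  y<z = Equivalence.to (iff 2F 0F) (s<s (s<s z<s))

increasing-unique : ∀ {w w′} → AllPairs _<_ w → AllPairs _<_ w′ → w ↭ w′ → w ≡ w′
increasing-unique w↗ w′↗ w↭w′ = ≋⇒≡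
  (↗↭↗⇒≋ ≤-totalOrder (sorted w↗) (sorted w′↗) (↭⇒↭ₛ w↭w′))
  where sorted = λ {w} (w↗ : AllPairs _<_ w) → AllPairs⇒Sorted ≤-totalOrder (AllPairs.map <⇒≤ w↗)

-- If the two order permutations are equal, nothing changes; otherwise both
-- factors are equivalent to their common increasing rearrangement.
replace⇒~ : ∀ {n w w′} → Replace K₀ n w w′ → w ~ w′
replace⇒~ (replace p q u v σ τ perm perm′ (_ , σ⇔u) (_ , τ⇔v) (inj₁ ≡.refl)) =
  ~-reflexive (cong (λ u → p ++ toList u ++ q)
    (same-order⇒≡ u v (++-cancel-↭ p q (trans perm (↭-sym perm′)))
      (λ i j → mk⇔ (Equivalence.to (τ⇔v i j) ∘ Equivalence.from (σ⇔u i j))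
                   (Equivalence.to (σ⇔u i j) ∘ Equivalence.from (τ⇔v i j)))))
replace⇒~ (replace p q u v σ τ perm perm′ σu τv (inj₂ (here (σ∈ , τ∈))))
  with s , s↗ , u~s ← block-sorts σ∈ σu | t , t↗ , v~t ← block-sorts τ∈ τv =
  ~-++ˡ p (~-++ʳ q (~-trans u~s (~-trans (~-reflexive s≡t) (~-sym v~t))))
  where
  s≡t : s ≡ t
  s≡t = increasing-unique s↗ t↗
    (trans (↭-sym (~⇒↭ u~s)) (trans (++-cancel-↭ p q (trans perm (↭-sym perm′))) (~⇒↭ v~t)))

-- The order of letters x < y < z, indexed by Fin 3, is that of 1, 2, 3.
pattern-iff : ∀ {x y z} → x < y → y < z → ∀ s t →
              (suc (toℕ s) < suc (toℕ t)) ⇔ (lookup (x ∷ y ∷ z ∷ []) s < lookup (x ∷ y ∷ z ∷ []) t)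
pattern-iff x<y y<z 0F 0F = mk⇔ (λ { (s≤s ()) }) (λ x<x → contradiction x<x (<-irrefl ≡.refl))
pattern-iff x<y y<z 0F 1F = mk⇔ (λ _ → x<y) (λ _ → s<s z<s)
pattern-iff x<y y<z 0F 2F = mk⇔ (λ _ → <-trans x<y y<z) (λ _ → s<s z<s)
pattern-iff x<y y<z 1F 0F = mk⇔ (λ { (s≤s ()) }) (λ y<x → contradiction y<x (<-asym x<y))
pattern-iff x<y y<z 1F 1F = mk⇔ (λ { (s≤s (s≤s ())) }) (λ x<x → contradiction x<x (<-irrefl ≡.refl))
pattern-iff x<y y<z 1F 2F = mk⇔ (λ _ → y<z) (λ _ → s<s (s<s z<s))
pattern-iff x<y y<z 2F 0F = mk⇔ (λ { (s≤s ()) }) (λ z<x → contradiction z<x (<-asym (<-trans x<y y<z)))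
pattern-iff x<y y<z 2F 1F = mk⇔ (λ { (s≤s (s≤s ())) }) (λ z<y → contradiction z<y (<-asym y<z))
pattern-iff x<y y<z 2F 2F = mk⇔ (λ { (s≤s (s≤s (s≤s ()))) }) (λ x<x → contradiction x<x (<-irrefl ≡.refl))

-- Arranging x < y < z by the indices r gives a word whose order permutation is
-- the same arrangement of 1, 2, 3.
arrangement : ∀ {x y z} → x < y → y < z → (r : Vec (Fin 3) 3) →
              IsPerm 3 (toList (Vec.map (suc ∘ toℕ) r)) →
              Vec.map (suc ∘ toℕ) r IsOrderPermOf Vec.map (lookup (x ∷ y ∷ z ∷ [])) r
arrangement {x} {y} {z} x<y y<z r perm = perm , λ i j →
  subst₂ _⇔_ (cong₂ _<_ (sym (lookup-map i (suc ∘ toℕ) r)) (sym (lookup-map j (suc ∘ toℕ) r)))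
             (cong₂ _<_ (sym (lookup-map i xyz r)) (sym (lookup-map j xyz r)))
             (pattern-iff x<y y<z (lookup r i) (lookup r j))
  where xyz = lookup (x ∷ y ∷ z ∷ [])

-- The prefix p collects the letters that precede the replaced factor.
step⇒replace : ∀ {n} p {w w′} → IsPerm n (p ++ w) → Step w w′ → Replace K₀ n (p ++ w) (p ++ w′)
step⇒replace p perm s@(comm x<y y<z) =
  replace p _ (_ ∷ _ ∷ _ ∷ []) (_ ∷ _ ∷ _ ∷ []) _ _
    perm (trans (++⁺ˡ p (↭-sym (step⇒↭ s))) perm)
    (arrangement x<y y<z (0F ∷ 1F ∷ 2F ∷ []) refl)
    (arrangement x<y y<z (0F ∷ 2F ∷ 1F ∷ []) (prep 1 (swap 3 2 refl)))
    (inj₂ (here (here ≡.refl , there (here ≡.refl))))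
step⇒replace p perm s@(move x<y y<z) =
  replace p _ (_ ∷ _ ∷ _ ∷ []) (_ ∷ _ ∷ _ ∷ []) _ _
    perm (trans (++⁺ˡ p (↭-sym (step⇒↭ s))) perm)
    (arrangement x<y y<z (0F ∷ 2F ∷ 1F ∷ []) (prep 1 (swap 3 2 refl)))
    (arrangement x<y y<z (2F ∷ 0F ∷ 1F ∷ []) (trans (swap 3 1 refl) (prep 1 (swap 3 2 refl))))
    (inj₂ (here (there (here ≡.refl) , there (there (here ≡.refl)))))
step⇒replace {n} p perm (there {h} {w} {w′} s) =
  subst₂ (Replace K₀ n) (++-assoc p [ h ] w) (++-assoc p [ h ] w′)
    (step⇒replace (p ++ [ h ]) (subst (IsPerm n) (sym (++-assoc p [ h ] w)) perm) s)

~⇒replace : ∀ {n w w′} → IsPerm n w → w ~ w′ → EqClosure (Replace K₀ n) w w′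
~⇒replace perm ε = ε
~⇒replace perm (fwd s ◅ w~) =
  fwd (step⇒replace [] perm s) ◅ ~⇒replace (trans (↭-sym (step⇒↭ s)) perm) w~
~⇒replace perm (bwd s ◅ w~) =
  bwd (step⇒replace [] perm′ s) ◅ ~⇒replace perm′ w~
  where perm′ = trans (step⇒↭ s) perm

-- Counting the classes

-- The letters 1, ..., n as a vector.
letters : ∀ n → ∃ λ (V : Vec ℕ n) → toList V ≡ map suc (upTo n)
letters n = go (≡.trans (length-map suc (upTo n)) (length-upTo n))
  where
  go : ∀ {w : List ℕ} → length w ≡ n → ∃ λ (V : Vec ℕ n) → toList V ≡ w
  go {w} ≡.refl = Vec.fromList w , toList∘fromList w

letters-increasing : ∀ n → AllPairs _<_ (map suc (upTo n))
letters-increasing n = AllPairs.map⁺ (AllPairs.applyUpTo⁺₁ _ n (λ i<j _ → s<s i<j))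

-- The number of codes of words in n letters.
classes : ℕ → ℕ
classes zero          = 1
classes (suc zero)    = 1
classes (suc (suc n)) = classes (suc n) + n * classes n + 1

classes↔Code : ∀ n → Fin (classes n) ↔ Code n
classes↔Code zero          = 1↔⊤
classes↔Code (suc zero)    = 1↔⊤
classes↔Code (suc (suc n)) =
  ↔-trans +↔⊎ (↔-trans +↔⊎ (classes↔Code (suc n) ⊎-↔ ↔-trans *↔× (↔-refl ×-↔ classes↔Code n)) ⊎-↔ 1↔⊤)

classCount : ∀ n → HasClassCount K₀ n (classes n)
classCount n with V , eq ← letters n = record
  { to        = from ∘ code n V ∘ proj₁
  ; cong      = λ {(w , w↭)} s → cong from (respects w↭ s)
  ; bijective = (λ {w w′} → inj {w} {w′}) , surj
  }
  where
  open Inverse (classes↔Code n) using (to; from; strictlyInverseˡ; strictlyInverseʳ)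
  V↗ : Increasing V
  V↗ = subst (AllPairs _<_) (sym eq) (letters-increasing n)
  perm : ∀ {w} → IsPerm n w → w ↭ toList V
  perm = subst (_ ↭_) (sym eq)
  respects : ∀ {w w′} → IsPerm n w → EqClosure (Replace K₀ n) w w′ → code n V w ≡ code n V w′
  respects w↭ s = code-~ n V V↗ (perm w↭) (Eq.fold (Eq.isEquivalence Step) replace⇒~ s)
  inj : ∀ {w w′ : S n} → from (code n V (proj₁ w)) ≡ from (code n V (proj₁ w′)) →
        EqClosure (Replace K₀ n) (proj₁ w) (proj₁ w′)
  inj {w , w↭} {w′ , w′↭} same = ~⇒replace w↭ (begin
    w                       ≈⟨ ~-decode n V V↗ (perm w↭) ⟩
    decode n V (code n V w)   ≡⟨ cong (decode n V) codes≡ ⟩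
    decode n V (code n V w′)  ≈⟨ ~-decode n V V↗ (perm w′↭) ⟨
    w′                      ∎)
    where
    open ~-Reasoning
    codes≡ : code n V w ≡ code n V w′
    codes≡ = ≡.trans (sym (strictlyInverseˡ _)) (≡.trans (cong to same) (strictlyInverseˡ _))
  surj : ∀ i → ∃ λ (w : S n) → ∀ {w′ : S n} → EqClosure (Replace K₀ n) (proj₁ w′) (proj₁ w) → from (code n V (proj₁ w′)) ≡ i
  surj i = (decode n V (to i) , subst (decode n V (to i) ↭_) eq (decode-↭ n V (to i))) , λ {(w′ , w′↭)} s →
    ≡.trans (cong from (≡.trans (respects w′↭ s) (code-decode n V V↗ (to i)))) (strictlyInverseʳ i)

theorem2p23 : Σ (ℕ → ℕ) λ f →
    (∀ n → HasClassCount K₀ n (f n)) ×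
    f 3 ≡ 4 ×
    f 4 ≡ 9 ×
    (∀ n → 5 ≤ n → f n ≡ f (n ∸ 1) + (n ∸ 2) * f (n ∸ 2) + 1)
theorem2p23 = classes , classCount , ≡.refl , ≡.refl , λ { (suc zero) (s≤s ()) ; (suc (suc n)) _ → ≡.refl }
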